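{- Let $\mathcal{L}=(L,\dot\wedge,\dot\vee,\star,\dot\to,0,1)$ be an SL-algebra. For $a\in L$ write $a\gg 0$ if for every $b\in L$, $a\,\dot\vee\, b=0$ implies $b=0$. For $a\in L$, $\mathbf{a}\in L^2$ and $r\in L$ with $r\gg 0$, let $$N_r(a)=\{b\in L: d_\star(a,b)<r\},\qquad \mathbf{N}_r(\mathbf{a})=\{\mathbf{b}\in L^2:\mathbf{d}_\star(\mathbf{a},\mathbf{b})<r\}.$$ Then $$T_\star=\{G\subseteq L:\ \forall a\in G\ \exists r\in L \text{ with } r\gg 0 \text{ and } N_r(a)\subseteq G\}$$ is a topology on $L$ and $$\mathbf{T}_\star=\{G\subseteq L^2:\ \forall \mathbf{a}\in G\ \exists r\in L \text{ with } r\gg 0 \text{ and } \mathbf{N}_r(\mathbf{a})\subseteq G\}$$ is a topology on $L^2$. Furthermore, the mappings $\star:(L^2,\mathbf{T}_\star)\to(L,T_\star)$ and $\dot\to:(L^2,\mathbf{T}_\star)\to(L,T_\star)$ are continuous.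
   Context: An SL-algebra is an algebra $\mathcal{L}=(L,\dot\wedge,\dot\vee,\star,\dot\to,0,1)$ of type $(2,2,2,2,0,0)$ such that: (SL1) $(L,\dot\wedge,\dot\vee,0,1)$ is a bounded lattice with greatest element $1$ and smallest element $0$, where the order is given by $a\le b$ iff $a\,\dot\vee\, b=a$, so that $a\,\dot\vee\, b=\inf\{a,b\}$ and $a\,\dot\wedge\, b=\sup\{a,b\}$; (SL2) $(L,\star,0)$ is an Abelian monoid; (SL3) $a\ge b\,\dot\to\, c$ iff $a\star b\ge c$ for all $a,b,c\in L$; (SL4) $a\,\dot\wedge\, b=a\star(a\,\dot\to\, b)$ for all $a,b\in L$; (SL5) $(a\,\dot\to\, b)\,\dot\vee\,(b\,\dot\to\, a)=0$ for all $a,b\in L$. Elements of $L^2$ are written $\mathbf{a}=(a_1,a_2)$. Define $d_\star:L\times L\to L$ by $d_\star(a,b)=(a\,\dot\to\, b)\star(b\,\dot\to\, a)$ and $\mathbf{d}_\star:L^2\times L^2\to L$ by $\mathbf{d}_\star(\mathbf{a},\mathbf{b})=d_\star(a_1,b_1)\star d_\star(a_2,b_2)$. Here $x<r$ means $x\le r$ and $x\ne r$. -}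

module Defs where

open import Level using (Level; suc; _⊔_)
open import Algebra.Core using (Op₂)
open import Algebra.Definitions using (Congruent₂)
open import Algebra.Lattice.Structures using (IsLattice)
open import Algebra.Structures using (IsCommutativeMonoid)
open import Data.Product using (_×_; _,_; Σ-syntax)
open import Data.Product.Relation.Binary.Pointwise.NonDependent using (_×ₛ_)
open import Function.Base using (_∘_)
open import Function.Bundles using (Func; _⇔_)
open import Relation.Binary.Bundles using (Setoid)
open import Relation.Binary.Core using (Rel)
open import Relation.Binary.Definitions using (_Respects_)
open import Relation.Nullary.Negation using (¬_)
open import Relation.Unary using (Pred; ∅; U; _∈_; _⊆_; _≐_; _∩_; ⋃)

private
  variable
    a b ℓ₁ ℓ₂ p q q′ : Level

-- The order is dual to the usual reading of the symbols: _∨_ is the infimum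
-- and _∧_ the supremum for _≤_, with 𝟎 the least and 𝟏 the greatest element.
record SLAlgebra c ℓ : Set (suc (c ⊔ ℓ)) where
  infix  4 _≈_ _≤_ _<_
  infixr 5 _⇒_
  infixr 6 _∨_
  infixr 7 _∧_
  infixl 8 _⋆_
  field
    Carrier : Set c
    _≈_     : Rel Carrier ℓ
    _∧_     : Op₂ Carrier
    _∨_     : Op₂ Carrier
    _⋆_     : Op₂ Carrier
    _⇒_     : Op₂ Carrier
    𝟎       : Carrier
    𝟏       : Carrier

  _≤_ : Rel Carrier ℓ
  x ≤ y = x ∨ y ≈ x

  _<_ : Rel Carrier ℓ
  x < y = x ≤ y × ¬ (x ≈ y)

  field
    isLattice             : IsLattice _≈_ _∨_ _∧_
    minimum               : ∀ x → 𝟎 ≤ x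
    maximum               : ∀ x → x ≤ 𝟏
    ⋆-isCommutativeMonoid : IsCommutativeMonoid _≈_ _⋆_ 𝟎
    ⇒-cong                : Congruent₂ _≈_ _⇒_
    residuated            : ∀ x y z → (y ⇒ z) ≤ x ⇔ z ≤ (x ⋆ y)
    divisible             : ∀ x y → x ∧ y ≈ x ⋆ (x ⇒ y)
    prelinear             : ∀ x y → (x ⇒ y) ∨ (y ⇒ x) ≈ 𝟎

  setoid : Setoid c ℓ
  setoid = record { isEquivalence = IsLattice.isEquivalence isLattice }

-- A subset of a set with equality _≈_ must not separate equal elements.
record Subset (S : Setoid a ℓ₁) (p : Level) : Set (a ⊔ ℓ₁ ⊔ suc p) where
  open Setoid S
  field
    pred     : Pred Carrier p
    respects : pred Respects _≈_

open Subset public using (pred)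

-- Subsets are equal when they have the same elements, so each axiom is stated
-- for every subset extensionally equal to the one named.  This also lets the
-- universe level i of the index type of a union be independent of the level p
-- of the subsets: the axiom applies to any union that is again a subset of
-- level p.
record IsTopology (i : Level) (S : Setoid a ℓ₁) (T : Pred (Subset S p) q)
                  : Set (a ⊔ ℓ₁ ⊔ suc p ⊔ q ⊔ suc i) where
  field
    ∅-open : ∀ G → pred G ≐ ∅ → T G
    U-open : ∀ G → pred G ≐ U → T G
    ∩-open : ∀ G H K → T G → T H → pred K ≐ pred G ∩ pred H → T K
    ⋃-open : ∀ {I : Set i} (F : I → Subset S p) (G : Subset S p) →
             (∀ j → T (F j)) → pred G ≐ ⋃ I (λ j → pred (F j)) → T G

preimage : {X : Setoid a ℓ₁} {Y : Setoid b ℓ₂} →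
           Func X Y → Subset Y p → Subset X p
preimage f G = record
  { pred     = pred G ∘ Func.to f
  ; respects = λ x≈y → Subset.respects G (Func.cong f x≈y)
  }

Continuous : {X : Setoid a ℓ₁} {Y : Setoid b ℓ₂} →
             Pred (Subset X p) q → Pred (Subset Y p) q′ → Func X Y →
             Set (b ⊔ ℓ₂ ⊔ suc p ⊔ q ⊔ q′)
Continuous T T′ f = ∀ G → T′ G → T (preimage f G)

module SLTopology {c ℓ} (𝓛 : SLAlgebra c ℓ) where

  open SLAlgebra 𝓛

  L² : Setoid c ℓ
  L² = setoid ×ₛ setoid

  infix 4 _≫𝟎
  _≫𝟎 : Pred Carrier (c ⊔ ℓ)
  x ≫𝟎 = ∀ y → x ∨ y ≈ 𝟎 → y ≈ 𝟎

  d⋆ : Carrier → Carrier → Carrier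
  d⋆ x y = (x ⇒ y) ⋆ (y ⇒ x)

  𝐝⋆ : Carrier × Carrier → Carrier × Carrier → Carrier
  𝐝⋆ (x₁ , x₂) (y₁ , y₂) = d⋆ x₁ y₁ ⋆ d⋆ x₂ y₂

  N : Carrier → Carrier → Pred Carrier ℓ
  N r x y = d⋆ x y < r

  𝐍 : Carrier → Carrier × Carrier → Pred (Carrier × Carrier) ℓ
  𝐍 r x y = 𝐝⋆ x y < r

  T⋆ : Pred (Subset setoid p) (c ⊔ ℓ ⊔ p)
  T⋆ G = ∀ x → x ∈ pred G → Σ[ r ∈ Carrier ] (r ≫𝟎 × N r x ⊆ pred G)

  𝐓⋆ : Pred (Subset L² p) (c ⊔ ℓ ⊔ p)
  𝐓⋆ G = ∀ x → x ∈ pred G → Σ[ r ∈ Carrier ] (r ≫𝟎 × 𝐍 r x ⊆ pred G)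

  ⋆-func : Func L² setoid
  ⋆-func = record
    { to   = λ (x₁ , x₂) → x₁ ⋆ x₂
    ; cong = λ (e₁ , e₂) → IsCommutativeMonoid.∙-cong ⋆-isCommutativeMonoid e₁ e₂
    }

  ⇒-func : Func L² setoid
  ⇒-func = record
    { to   = λ (x₁ , x₂) → x₁ ⇒ x₂
    ; cong = λ (e₁ , e₂) → ⇒-cong e₁ e₂
    }

{-# OPTIONS --safe #-}

-- Both topologies arise in the same way from an L-valued distance, and any
-- function on pairs would do: scales r ≫ 0 are closed under infima.  Continuity
-- holds with the same r on both sides, because ⋆ and ⇒ are non-expansive, which
-- follows from residuation and the monotonicity of ⋆.
module Submission where

open import Defs
open import Level using (Level; _⊔_)
open import Algebra.Bundles using (CommutativeMonoid)
open import Algebra.Lattice.Bundles using (Lattice)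
import Algebra.Lattice.Properties.Lattice as LatticeProperties
import Algebra.Properties.CommutativeSemigroup as CommutativeSemigroupProperties
open import Data.Empty using (⊥-elim)
open import Data.Product using (_×_; _,_; Σ-syntax; proj₁; proj₂)
open import Function.Bundles using (Func; Equivalence)
open import Relation.Binary.Bundles using (Setoid; Poset)
import Relation.Binary.Construct.NaturalOrder.Left as NaturalOrder
import Relation.Binary.Reasoning.PartialOrder as PosetReasoning
open import Relation.Unary using (Pred; _∈_; _⊆_)

private
  variable
    a b ℓ₁ ℓ₂ p : Level

module SLAlgebraProperties {c ℓ} (𝓛 : SLAlgebra c ℓ) where

  open SLAlgebra 𝓛
  open SLTopology 𝓛
  open Setoid setoid using (refl; sym; trans)

  lattice : Lattice c ℓ
  lattice = record { isLattice = isLattice }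

  ⋆-commutativeMonoid : CommutativeMonoid c ℓ
  ⋆-commutativeMonoid = record { isCommutativeMonoid = ⋆-isCommutativeMonoid }

  open CommutativeMonoid ⋆-commutativeMonoid
    using (commutativeSemigroup)
    renaming (assoc to ⋆-assoc; comm to ⋆-comm; ∙-cong to ⋆-cong)
  open CommutativeSemigroupProperties commutativeSemigroup using (interchange)
  open Lattice lattice using (∨-comm; ∨-assoc; ∨-congʳ; ∨-congˡ)
  open LatticeProperties lattice using (∨-isSemilattice; ∨-idem)

  private
    -- The library order reads `x ≈ x ∨ y`, the equation defining `_≤_` turned around; hence each
    -- use of `sym` when its laws are transferred.
    module ≤-Natural = Poset (NaturalOrder.poset _≈_ _∨_ ∨-isSemilattice)

  ≤-trans : ∀ {x y z} → x ≤ y → y ≤ z → x ≤ z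
  ≤-trans x≤y y≤z = sym (≤-Natural.trans (sym x≤y) (sym y≤z))

  ≤-poset : Poset c ℓ ℓ
  ≤-poset = record
    { _≤_ = _≤_
    ; isPartialOrder = record
      { isPreorder = record
        { isEquivalence = Setoid.isEquivalence setoid
        ; reflexive     = λ x≈y → sym (≤-Natural.reflexive x≈y)
        ; trans         = ≤-trans
        }
      ; antisym = λ x≤y y≤x → ≤-Natural.antisym (sym x≤y) (sym y≤x)
      }
    }

  open Poset ≤-poset using () renaming
    (refl to ≤-refl; antisym to ≤-antisym; reflexive to ≤-reflexive)
  open PosetReasoning ≤-poset

  ≤-<-trans : ∀ {x y z} → x ≤ y → y < z → x < z
  ≤-<-trans x≤y (y≤z , y≉z) =
    -- `x ≈ z` would close the cycle `z ≤ x ≤ y ≤ z` and force `y ≈ z`.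
    ≤-trans x≤y y≤z , λ x≈z → y≉z (≤-antisym y≤z (≤-trans (≤-reflexive (sym x≈z)) x≤y))

  <-≤-trans : ∀ {x y z} → x < y → y ≤ z → x < z
  <-≤-trans (x≤y , x≉y) y≤z =
    ≤-trans x≤y y≤z , λ x≈z → x≉y (≤-antisym x≤y (≤-trans y≤z (≤-reflexive (sym x≈z))))

  x∨y≤x : ∀ x y → x ∨ y ≤ x
  x∨y≤x x y = begin-equality
    (x ∨ y) ∨ x  ≈⟨ ∨-comm (x ∨ y) x ⟩
    x ∨ (x ∨ y)  ≈⟨ ∨-assoc x x y ⟨
    (x ∨ x) ∨ y  ≈⟨ ∨-congʳ (∨-idem x) ⟩
    x ∨ y        ∎

  x∨y≤y : ∀ x y → x ∨ y ≤ y
  x∨y≤y x y = trans (∨-assoc x y y) (∨-congˡ (∨-idem y))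

  -- The default scale, for places where any radius will do: the infimum of `𝟏` and `y` is `y`
  -- itself.
  𝟏≫𝟎 : 𝟏 ≫𝟎
  𝟏≫𝟎 y 𝟏∨y≈𝟎 = trans (sym (maximum y)) (trans (∨-comm y 𝟏) 𝟏∨y≈𝟎)

  -- After reassociation to `r ∨ (s ∨ y) ≈ 𝟎`, the scale `r` gives `s ∨ y ≈ 𝟎`, and then `s` gives
  -- `y ≈ 𝟎`.
  ∨-≫𝟎 : ∀ {r s} → r ≫𝟎 → s ≫𝟎 → r ∨ s ≫𝟎
  ∨-≫𝟎 {r} {s} r≫𝟎 s≫𝟎 y eq =
    s≫𝟎 y (r≫𝟎 (s ∨ y) (trans (sym (∨-assoc r s y)) eq))

  residuate : ∀ {x y z} → z ≤ x ⋆ y → (y ⇒ z) ≤ x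
  residuate {x} {y} {z} = Equivalence.from (residuated x y z)

  unresiduate : ∀ {x y z} → (y ⇒ z) ≤ x → z ≤ x ⋆ y
  unresiduate {x} {y} {z} = Equivalence.to (residuated x y z)

  -- Modus ponens in the dual order: `x ⇒ y` is the least `z` with `y ≤ z ⋆ x`.
  y≤[x⇒y]⋆x : ∀ x y → y ≤ (x ⇒ y) ⋆ x
  y≤[x⇒y]⋆x x y = unresiduate ≤-refl

  -- Residuation makes `_⋆ z` an upper adjoint: `z ⇒ x ⋆ z` lies below `x`, hence below `y`, and the
  -- adjunction leads back.
  ⋆-monoˡ-≤ : ∀ z {x y} → x ≤ y → x ⋆ z ≤ y ⋆ z
  ⋆-monoˡ-≤ z x≤y = unresiduate (≤-trans (residuate ≤-refl) x≤y)

  ⋆-monoʳ-≤ : ∀ z {x y} → x ≤ y → z ⋆ x ≤ z ⋆ y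
  ⋆-monoʳ-≤ z {x} {y} x≤y = begin
    z ⋆ x  ≈⟨ ⋆-comm z x ⟩
    x ⋆ z  ≤⟨ ⋆-monoˡ-≤ z x≤y ⟩
    y ⋆ z  ≈⟨ ⋆-comm y z ⟩
    z ⋆ y  ∎

  ⋆-mono-≤ : ∀ {x y u v} → x ≤ y → u ≤ v → x ⋆ u ≤ y ⋆ v
  ⋆-mono-≤ {y = y} {u = u} x≤y u≤v = ≤-trans (⋆-monoˡ-≤ u x≤y) (⋆-monoʳ-≤ y u≤v)

  -- The product of two instances of modus ponens, one per coordinate, with the residuals gathered
  -- on the left.
  ⋆-⇒-⋆-≤ : ∀ x₁ x₂ y₁ y₂ → (x₁ ⋆ x₂ ⇒ y₁ ⋆ y₂) ≤ (x₁ ⇒ y₁) ⋆ (x₂ ⇒ y₂)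
  ⋆-⇒-⋆-≤ x₁ x₂ y₁ y₂ = residuate (begin
    y₁ ⋆ y₂                                  ≤⟨ ⋆-mono-≤ (y≤[x⇒y]⋆x x₁ y₁) (y≤[x⇒y]⋆x x₂ y₂) ⟩
    ((x₁ ⇒ y₁) ⋆ x₁) ⋆ ((x₂ ⇒ y₂) ⋆ x₂)      ≈⟨ interchange _ _ _ _ ⟩
    ((x₁ ⇒ y₁) ⋆ (x₂ ⇒ y₂)) ⋆ (x₁ ⋆ x₂)      ∎)

  -- Modus ponens is chained along `y₁`, `x₁`, `x₂`, `y₂`. The factor `y₁ ⇒ x₁` is reversed because
  -- `_⇒_` is antitone in its first argument.
  ⇒-⇒-⇒-≤ : ∀ x₁ x₂ y₁ y₂ → ((x₁ ⇒ x₂) ⇒ (y₁ ⇒ y₂)) ≤ (y₁ ⇒ x₁) ⋆ (x₂ ⇒ y₂)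
  -- The outer residuation moves `x₁ ⇒ x₂` to the right-hand side, the inner one `y₁`.
  ⇒-⇒-⇒-≤ x₁ x₂ y₁ y₂ = residuate (residuate (begin
    y₂                                             ≤⟨ y≤[x⇒y]⋆x x₂ y₂ ⟩
    (x₂ ⇒ y₂) ⋆ x₂                                 ≤⟨ ⋆-monoʳ-≤ _ (y≤[x⇒y]⋆x x₁ x₂) ⟩
    (x₂ ⇒ y₂) ⋆ ((x₁ ⇒ x₂) ⋆ x₁)                   ≤⟨ ⋆-monoʳ-≤ _ (⋆-monoʳ-≤ _ (y≤[x⇒y]⋆x y₁ x₁)) ⟩
    (x₂ ⇒ y₂) ⋆ ((x₁ ⇒ x₂) ⋆ ((y₁ ⇒ x₁) ⋆ y₁))     ≈⟨ ⋆-assoc _ _ _ ⟨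
    ((x₂ ⇒ y₂) ⋆ (x₁ ⇒ x₂)) ⋆ ((y₁ ⇒ x₁) ⋆ y₁)     ≈⟨ ⋆-assoc _ _ _ ⟨
    (((x₂ ⇒ y₂) ⋆ (x₁ ⇒ x₂)) ⋆ (y₁ ⇒ x₁)) ⋆ y₁     ≈⟨ ⋆-cong (⋆-comm _ _) refl ⟩
    ((y₁ ⇒ x₁) ⋆ ((x₂ ⇒ y₂) ⋆ (x₁ ⇒ x₂))) ⋆ y₁     ≈⟨ ⋆-cong (⋆-assoc _ _ _) refl ⟨
    (((y₁ ⇒ x₁) ⋆ (x₂ ⇒ y₂)) ⋆ (x₁ ⇒ x₂)) ⋆ y₁     ∎))

  -- The one-sided bound is used in both directions; `interchange` then regroups the four residuals
  -- by coordinate instead of by direction.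
  ⋆-nonExpansive : ∀ x y → d⋆ (proj₁ x ⋆ proj₂ x) (proj₁ y ⋆ proj₂ y) ≤ 𝐝⋆ x y
  ⋆-nonExpansive (x₁ , x₂) (y₁ , y₂) = begin
    d⋆ (x₁ ⋆ x₂) (y₁ ⋆ y₂)                                 ≤⟨ ⋆-mono-≤ (⋆-⇒-⋆-≤ x₁ x₂ y₁ y₂) (⋆-⇒-⋆-≤ y₁ y₂ x₁ x₂) ⟩
    ((x₁ ⇒ y₁) ⋆ (x₂ ⇒ y₂)) ⋆ ((y₁ ⇒ x₁) ⋆ (y₂ ⇒ x₂))      ≈⟨ interchange _ _ _ _ ⟩
    d⋆ x₁ y₁ ⋆ d⋆ x₂ y₂                                    ∎

  ⇒-nonExpansive : ∀ x y → d⋆ (proj₁ x ⇒ proj₂ x) (proj₁ y ⇒ proj₂ y) ≤ 𝐝⋆ x y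
  ⇒-nonExpansive (x₁ , x₂) (y₁ , y₂) = begin
    d⋆ (x₁ ⇒ x₂) (y₁ ⇒ y₂)                                 ≤⟨ ⋆-mono-≤ (⇒-⇒-⇒-≤ x₁ x₂ y₁ y₂) (⇒-⇒-⇒-≤ y₁ y₂ x₁ x₂) ⟩
    ((y₁ ⇒ x₁) ⋆ (x₂ ⇒ y₂)) ⋆ ((x₁ ⇒ y₁) ⋆ (y₂ ⇒ x₂))      ≈⟨ interchange _ _ _ _ ⟩
    -- The reversed first argument leaves the factors of `d⋆ x₁ y₁` in the wrong order.
    ((y₁ ⇒ x₁) ⋆ (x₁ ⇒ y₁)) ⋆ ((x₂ ⇒ y₂) ⋆ (y₂ ⇒ x₂))      ≈⟨ ⋆-cong (⋆-comm _ _) refl ⟩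
    d⋆ x₁ y₁ ⋆ d⋆ x₂ y₂                                    ∎

  -- `T⋆` and `𝐓⋆` unfold to the instances at `d⋆` and `𝐝⋆`, so results about an arbitrary `D` apply
  -- to both without conversion.
  BallOpen : (S : Setoid a ℓ₁) → (Setoid.Carrier S → Setoid.Carrier S → Carrier) →
             Pred (Subset S p) (a ⊔ c ⊔ ℓ ⊔ p)
  BallOpen S D G =
    ∀ x → x ∈ pred G → Σ[ r ∈ Carrier ] (r ≫𝟎 × (λ y → D x y < r) ⊆ pred G)

  ballOpen-isTopology : ∀ i (S : Setoid a ℓ₁) D → IsTopology i S (BallOpen {p = p} S D)
  ballOpen-isTopology i S D = record
    { ∅-open = λ { G (G⊆∅ , _) x x∈G → 𝟏 , 𝟏≫𝟎 , λ _ → ⊥-elim (G⊆∅ x∈G) }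
    ; U-open = λ { G (_ , U⊆G) x _ → 𝟏 , 𝟏≫𝟎 , λ _ → U⊆G _ }
    ; ∩-open = λ { G H K G-open H-open (K⊆G∩H , G∩H⊆K) x x∈K →
        let x∈G , x∈H         = K⊆G∩H x∈K
            r , r≫𝟎 , ball⊆G  = G-open x x∈G
            s , s≫𝟎 , ball⊆H  = H-open x x∈H
        -- The order need not be total, so the infimum replaces the smaller of the two radii.
        in r ∨ s , ∨-≫𝟎 r≫𝟎 s≫𝟎 , λ D<r∨s →
             G∩H⊆K (ball⊆G (<-≤-trans D<r∨s (x∨y≤x r s)) , ball⊆H (<-≤-trans D<r∨s (x∨y≤y r s))) }
    ; ⋃-open = λ { F G F-open (G⊆⋃F , ⋃F⊆G) x x∈G →
        let j , x∈Fj           = G⊆⋃F x∈G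
            r , r≫𝟎 , ball⊆Fj  = F-open j x x∈Fj
        in r , r≫𝟎 , λ D<r → ⋃F⊆G (j , ball⊆Fj D<r) }
    }

  -- Around each `x`, the ball of radius `r` for `D` is mapped into the ball of radius `r` for `D′`
  -- around the image of `x`.
  nonExpansive⇒continuous :
    {S : Setoid a ℓ₁} {S′ : Setoid b ℓ₂} (f : Func S S′) →
    ∀ D D′ → (∀ x y → D′ (Func.to f x) (Func.to f y) ≤ D x y) →
    Continuous (BallOpen {p = p} S D) (BallOpen {p = p} S′ D′) f
  nonExpansive⇒continuous f D D′ f-nonExpansive G G-open x fx∈G =
    let r , r≫𝟎 , ball⊆G = G-open (Func.to f x) fx∈G
    in r , r≫𝟎 , λ D<r → ball⊆G (≤-<-trans (f-nonExpansive x _) D<r)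

theorem5p8 : ∀ (c ℓ p i : Level) (𝓛 : SLAlgebra c ℓ) →
    let open SLAlgebra 𝓛 using (setoid)
        open SLTopology 𝓛
    in IsTopology i setoid (T⋆ {p})
     × IsTopology i L² (𝐓⋆ {p})
     × Continuous (𝐓⋆ {p}) (T⋆ {p}) ⋆-func
     × Continuous (𝐓⋆ {p}) (T⋆ {p}) ⇒-func
theorem5p8 c ℓ p i 𝓛 =
    ballOpen-isTopology i setoid d⋆
  , ballOpen-isTopology i L² 𝐝⋆
  , nonExpansive⇒continuous ⋆-func 𝐝⋆ d⋆ ⋆-nonExpansive
  , nonExpansive⇒continuous ⇒-func 𝐝⋆ d⋆ ⇒-nonExpansive
  where
  open SLAlgebra 𝓛 using (setoid)
  open SLTopology 𝓛
  open SLAlgebraProperties 𝓛
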